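{- Let $k\ge 4$ and let $\delta$ be a set partition of $[k]$ all of whose blocks are singletons except for exactly one block of size two. Let $\sigma_k$ be the partition of $[k]$ into $k$ singletons. Then $|\Pi_n(\delta)|<|\Pi_n(\sigma_k)|$ for all $n>k$. Consequently $\delta\prec\sigma_k$.
   Context: The standardization of a set partition of a finite set $S\subset\mathbb{Z}_{>0}$ replaces the $i$-th smallest element of $S$ by $i$. A set partition $\pi$ of $[n]$ contains $\tau\vdash[k]$ if for some $S\subseteq[n]$ the standardization of the restriction of $\pi$ to $S$ is $\tau$; otherwise it avoids $\tau$. $\Pi_n(\tau)$ is the set of set partitions of $[n]$ avoiding $\tau$. For $\tau,\pi\vdash[k]$, $\tau\prec\pi$ means $|\Pi_n(\tau)|\le|\Pi_n(\pi)|$ for all $n>k$ and there exists $m\ge k$ with $|\Pi_n(\tau)|<|\Pi_n(\pi)|$ for all $n>m$. -}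

module Defs where

open import Data.Nat using (ℕ; zero; suc; _≤_; _<_; _⊔_)
open import Data.Fin using (Fin; toℕ) renaming (_<_ to _<ᶠ_)
open import Data.Vec using (Vec; []; _∷_; lookup; tabulate)
open import Data.List using (List; length)
open import Data.List.Relation.Unary.Unique.Propositional using (Unique)
open import Data.List.Membership.Propositional using (_∈_)
open import Data.Product using (Σ; _×_; ∃-syntax)
open import Data.Sum using (_⊎_)
open import Function.Bundles using (_⇔_)
open import Relation.Nullary using (¬_)
open import Relation.Binary.PropositionalEquality using (_≡_; _≢_)

-- A set partition of [n] = {1,…,n} is encoded by its (canonical) restricted
-- growth string: position i (0-based, i.e. element i+1 of [n]) holds the
-- label of its block, blocks being labelled 0,1,2,… in order of their
-- smallest element.  'RGSFrom m v' : every entry is ≤ m, the number of blocks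
-- opened so far (so a new entry either reuses a block or opens block m).
data RGSFrom : ℕ → {n : ℕ} → Vec ℕ n → Set where
  []  : ∀ {m} → RGSFrom m []
  _∷_ : ∀ {m n x} {xs : Vec ℕ n} → x ≤ m → RGSFrom (m ⊔ suc x) xs → RGSFrom m (x ∷ xs)

IsRGS : ∀ {n} → Vec ℕ n → Set
IsRGS v = RGSFrom 0 v

-- Set partitions of [n]: the vectors v satisfying IsRGS v.
-- Two elements i, j lie in the same block of v iff lookup v i ≡ lookup v j.

-- π ⊢ [n] contains τ ⊢ [k]: there is S = {f 0 < f 1 < … < f (k-1)} ⊆ [n]
-- such that the standardization of π restricted to S is τ, i.e. for all i, j,
-- f i and f j are in the same block of π iff i and j are in the same block of τ.
Contains : ∀ {n k} → Vec ℕ n → Vec ℕ k → Set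
Contains {n} {k} π τ =
  Σ (Fin k → Fin n) λ f →
    (∀ i j → i <ᶠ j → f i <ᶠ f j) ×
    (∀ i j → (lookup π (f i) ≡ lookup π (f j)) ⇔ (lookup τ i ≡ lookup τ j))

Avoids : ∀ {n k} → Vec ℕ n → Vec ℕ k → Set
Avoids π τ = ¬ Contains π τ

InΠ : ∀ {k} (n : ℕ) → Vec ℕ k → Vec ℕ n → Set
InΠ n τ v = IsRGS v × Avoids v τ

HasSize : ∀ {n} → (Vec ℕ n → Set) → ℕ → Set
HasSize {n} P c =
  Σ (List (Vec ℕ n)) λ L → Unique L × length L ≡ c × (∀ v → (v ∈ L) ⇔ P v)

CardLt : ∀ {k} → ℕ → Vec ℕ k → Vec ℕ k → Set
CardLt n τ π = ∃[ a ] ∃[ b ] (HasSize (InΠ n τ) a × HasSize (InΠ n π) b × a < b)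

CardLe : ∀ {k} → ℕ → Vec ℕ k → Vec ℕ k → Set
CardLe n τ π = ∃[ a ] ∃[ b ] (HasSize (InΠ n τ) a × HasSize (InΠ n π) b × a ≤ b)

_≺_ : ∀ {k} → Vec ℕ k → Vec ℕ k → Set
_≺_ {k} τ π =
  (∀ n → k < n → CardLe n τ π) ×
  (∃[ m ] (k ≤ m × (∀ n → m < n → CardLt n τ π)))

σ : (k : ℕ) → Vec ℕ k
σ k = tabulate toℕ

OneDoubleton : ∀ {k} → Vec ℕ k → Set
OneDoubleton {k} δ =
  Σ (Fin k) λ i → Σ (Fin k) λ j →
    i <ᶠ j × lookup δ i ≡ lookup δ j ×
    (∀ a b → a ≢ b → lookup δ a ≡ lookup δ b →
       (a ≡ i × b ≡ j) ⊎ (a ≡ j × b ≡ i))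

{-# OPTIONS --safe #-}
module Submission where

-- Let δ have p singletons before the first element of its doubleton, q between the two and r after
-- them, so k = p + q + r + 2.  Read a partition from its right end until r blocks have been met and
-- then from its left end, labelling blocks as they are met.  If δ is avoided, then in the second
-- phase, with m blocks open, an element can join only the r blocks met first, the next p, the q
-- latest, or a new block: a label x ≥ r + p with x + q < m would be the doubleton of a copy of δ.
-- So reducing labels x ≥ r + p modulo q + 1 (into r + p, …, r + p + q) is injective, and the result
-- is the reading of a partition with at most k - 1 blocks, i.e. one avoiding σ k.  A partition with
-- at most k - 1 blocks that contains δ, but whose reading satisfies the restriction above, is fixed
-- by the reduction and hence missed; for n > k and p + q + r ≥ 2 one exists.

open import Defs
open import Data.Bool using (Bool; true; false; T)
open import Data.Fin using (Fin; zero; suc; toℕ; fromℕ; fromℕ<; inject₁) renaming (_<_ to _<ᶠ_)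
import Data.Fin.Properties as Fin
open import Data.List as List
  using (List; []; _∷_; [_]; _++_; downFrom; length; replicate; filter; upTo; allFin; cartesianProductWith)
open import Data.List.Membership.Propositional using (_∈_)
open import Data.List.Membership.Propositional.Properties
  using (∈-upTo⁺; ∈-allFin; ∈-cartesianProductWith⁺; ∈-filter⁺; ∈-filter⁻; ∈-lookup)
open import Data.List.Properties using (++-assoc; ++-identityʳ; length-++; length-replicate; length-downFrom)
open import Data.List.Relation.Binary.Sublist.Propositional
  using (_⊆_; []; _∷_; _∷ʳ_; ⊆-refl; ⊆-trans; ⊆-reflexive; minimum)
open import Data.List.Relation.Binary.Sublist.Propositional.Properties using (++⁺; ++⁺ˡ; ++⁺ʳ)
open import Data.List.Relation.Unary.All as All using (All; []; _∷_)
import Data.List.Relation.Unary.All.Properties as All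
open import Data.List.Relation.Unary.AllPairs using ([]; _∷_)
open import Data.List.Relation.Unary.Any as Any using (Any; here; any?)
open import Data.List.Relation.Unary.Any.Properties using (lookup-index)
open import Data.List.Relation.Unary.Unique.Propositional using (Unique)
import Data.List.Relation.Unary.Unique.Propositional.Properties as Unique
open import Data.Nat
open import Data.Nat.DivMod
open import Data.Nat.Properties
open import Data.Nat.Tactic.RingSolver using (solve-∀)
open import Data.Product using (Σ; _×_; _,_; proj₁; proj₂; ∃-syntax)
open import Data.Sum using (_⊎_; inj₁; inj₂)
open import Data.Vec
  using (Vec; []; _∷_; lookup; map; initLast; head; tail; toList; fromList; tabulate)
  renaming (_∷ʳ_ to _∷ʳᵛ_)
open import Data.Vec.Properties
  using (map-∷ʳ; lookup-map; map-∘; toList-∷ʳ; lookup∘tabulate; ∷-injective; toList∘fromList)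
import Data.Vec.Relation.Unary.All.Properties as VecAll
open import Function using (_∘_)
open import Function.Bundles using (_⇔_; mk⇔; Equivalence)
open import Function.Definitions using (Injective)
open import Relation.Binary.Definitions using (tri<; tri≈; tri>)
open import Relation.Binary.PropositionalEquality hiding ([_])
open import Relation.Nullary using (¬_; Dec; yes; no; contradiction)
open import Relation.Nullary.Decidable using (map′; ¬?; _×-dec_; _→-dec_)

open Equivalence using (to; from)

private
  variable
    n k m r : ℕ

-- Kernels and words

-- Both vectors describe the same set partition, with labels that need not be canonical. As a record
-- it lets `v` and `w` be inferred from a proof.
record SameKernel (v w : Vec ℕ n) : Set where
  field
    kernel : ∀ i j → (lookup v i ≡ lookup v j) ⇔ (lookup w i ≡ lookup w j)

open SameKernel

sameKernel-sym : {v w : Vec ℕ n} → SameKernel v w → SameKernel w v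
kernel (sameKernel-sym h) i j = mk⇔ (from (kernel h i j)) (to (kernel h i j))

sameKernel-trans : {u v w : Vec ℕ n} → SameKernel u v → SameKernel v w → SameKernel u w
kernel (sameKernel-trans g h) i j =
  mk⇔ (to (kernel h i j) ∘ to (kernel g i j)) (from (kernel g i j) ∘ from (kernel h i j))

sameKernel-map : ∀ {ρ} → Injective _≡_ _≡_ ρ → (v : Vec ℕ n) → SameKernel v (map ρ v)
kernel (sameKernel-map {ρ = ρ} inj v) i j rewrite lookup-map i ρ v | lookup-map j ρ v = mk⇔ (cong ρ) inj

contains-resp : {v w : Vec ℕ n} (τ : Vec ℕ k) → SameKernel v w → Contains v τ → Contains w τ
contains-resp τ h (f , mono , ker) = f , mono , λ i j →
  let h′ = kernel h (f i) (f j) in mk⇔ (to (ker i j) ∘ from h′) (to h′ ∘ from (ker i j))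

insert : Bool → ℕ → Vec ℕ n → Vec ℕ (suc n)
insert true  x v = v ∷ʳᵛ x
insert false x v = x ∷ v

newPos : Bool → Fin (suc n)
newPos true  = fromℕ _
newPos false = zero

oldPos : Bool → Fin n → Fin (suc n)
oldPos true  = inject₁
oldPos false = suc

lookup-newPos : ∀ s x (v : Vec ℕ n) → lookup (insert s x v) (newPos s) ≡ x
lookup-newPos false x v       = refl
lookup-newPos true  x []      = refl
lookup-newPos true  x (y ∷ v) = lookup-newPos true x v

lookup-oldPos : ∀ s x (v : Vec ℕ n) i → lookup (insert s x v) (oldPos s i) ≡ lookup v i
lookup-oldPos false x v       i       = refl
lookup-oldPos true  x (y ∷ v) zero    = refl
lookup-oldPos true  x (y ∷ v) (suc i) = lookup-oldPos true x v i

map-insert : ∀ f s x (v : Vec ℕ n) → map f (insert s x v) ≡ insert s (f x) (map f v)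
map-insert f true  x v = map-∷ʳ f x v
map-insert f false x v = refl

uninsert : ∀ s (v : Vec ℕ (suc n)) → ∃[ x ] ∃[ w ] v ≡ insert s x w
uninsert false (x ∷ w) = x , w , refl
uninsert true  v with w , x , eq ← initLast v = x , w , eq

-- The word whose letters, read from its right end until r distinct labels have been met and then
-- from its left end, are c; the number of labels met so far is m.
arrange : (r m : ℕ) → Vec ℕ n → Vec ℕ n
arrange r m []      = []
arrange r m (x ∷ c) = insert (m <ᵇ r) x (arrange r (m ⊔ suc x) c)

<⊔suc⇒ : ∀ {e m x} → x ≤ m → e < m ⊔ suc x → e < m ⊎ e ≡ x
<⊔suc⇒ {e} {m} {x} x≤m e< with e <? m
... | yes e<m = inj₁ e<m
... | no  e≮m with ⊔-sel m (suc x)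
...   | inj₁ eq = contradiction (subst (e <_) eq e<) e≮m
...   | inj₂ eq = inj₂ (≤-antisym (s≤s⁻¹ (subst (e <_) eq e<)) (≤-trans x≤m (≮⇒≥ e≮m)))

-- The induction hypothesis for comparing unread parts: the `m` labels already met have a fixed
-- meaning and must agree literally, the others only up to renaming.
_≈[_]_ : Vec ℕ n → ℕ → Vec ℕ n → Set
v ≈[ m ] w = SameKernel v w × (∀ i e → e < m → (lookup v i ≡ e) ⇔ (lookup w i ≡ e))

-- The end that is read next depends on `m` alone, so the first letters of `c` and `d` stand at the
-- same position. A letter below `m` is pinned by the literal agreement; otherwise both letters are
-- the new label `m`.
arrange-injective : ∀ r {m} (c d : Vec ℕ n) → RGSFrom m c → RGSFrom m d →
                    arrange r m c ≈[ m ] arrange r m d → c ≡ d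
arrange-injective r [] [] _ _ _ = refl
arrange-injective r {m} (x ∷ c) (y ∷ d) (x≤m ∷ rc) (y≤m ∷ rd) (ker , env) =
  conclude x≡y
  where
  s = m <ᵇ r
  C = arrange r (m ⊔ suc x) c
  D = arrange r (m ⊔ suc y) d

  x≡y : x ≡ y
  x≡y with m≤n⇒m<n∨m≡n x≤m | m≤n⇒m<n∨m≡n y≤m
  ... | inj₁ x<m | _ =
    sym (trans (sym (lookup-newPos s y D)) (to (env (newPos s) x x<m) (lookup-newPos s x C)))
  ... | inj₂ _ | inj₁ y<m =
    trans (sym (lookup-newPos s x C)) (from (env (newPos s) y y<m) (lookup-newPos s y D))
  ... | inj₂ x≡m | inj₂ y≡m = trans x≡m (sym y≡m)

  rest : ∀ {d} → SameKernel (insert s x C) (insert s x d) →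
         (∀ i e → e < m → (lookup (insert s x C) i ≡ e) ⇔ (lookup (insert s x d) i ≡ e)) →
         C ≈[ m ⊔ suc x ] d
  rest {d} ker env = ker′ , env′
    where
    ker′ : SameKernel C d
    kernel ker′ i j with h ← kernel ker (oldPos s i) (oldPos s j)
      rewrite lookup-oldPos s x C i | lookup-oldPos s x C j
            | lookup-oldPos s x d i | lookup-oldPos s x d j = h

    env′ : ∀ i e → e < m ⊔ suc x → (lookup C i ≡ e) ⇔ (lookup d i ≡ e)
    env′ i e e< with <⊔suc⇒ x≤m e<
    ... | inj₁ e<m with h ← env (oldPos s i) e e<m
      rewrite lookup-oldPos s x C i | lookup-oldPos s x d i = h
    -- The label `x` just read may be new; its occurrences are the positions in the same block as
    -- the position just read.
    env′ i e e< | inj₂ refl with h ← kernel ker (oldPos s i) (newPos s)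
      rewrite lookup-oldPos s x C i | lookup-newPos s x C
            | lookup-oldPos s x d i | lookup-newPos s x d = h

  conclude : x ≡ y → x ∷ c ≡ y ∷ d
  conclude refl = cong (x ∷_) (arrange-injective r c d rc rd (rest ker env))

arrange-sameKernel-injective : ∀ r {c d : Vec ℕ n} → IsRGS c → IsRGS d →
  SameKernel (arrange r 0 c) (arrange r 0 d) → c ≡ d
arrange-sameKernel-injective r rc rd h = arrange-injective r _ _ rc rd (h , λ _ _ ())

-- Existence of a reading order

swap : ℕ → ℕ → ℕ → ℕ
swap a b x with x ≟ a | x ≟ b
... | yes _ | _     = b
... | no _  | yes _ = a
... | no _  | no _  = x

swap-left : ∀ a b → swap a b a ≡ b
swap-left a b with a ≟ a
... | yes _  = refl
... | no a≢a = contradiction refl a≢a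

swap-right : ∀ a b → swap a b b ≡ a
swap-right a b with b ≟ a | b ≟ b
... | yes b≡a | _      = b≡a
... | no _    | yes _  = refl
... | no _    | no b≢b = contradiction refl b≢b

swap-other : ∀ {a b x} → x ≢ a → x ≢ b → swap a b x ≡ x
swap-other {a} {b} {x} x≢a x≢b with x ≟ a | x ≟ b
... | yes x≡a | _       = contradiction x≡a x≢a
... | no _    | yes x≡b = contradiction x≡b x≢b
... | no _    | no _    = refl

swap-involutive : ∀ a b x → swap a b (swap a b x) ≡ x
swap-involutive a b x with x ≟ a | x ≟ b
... | yes refl | _        = swap-right x b
... | no _     | yes refl = swap-left a x
... | no x≢a   | no x≢b   = swap-other x≢a x≢b

swap-injective : ∀ a b → Injective _≡_ _≡_ (swap a b)
swap-injective a b {x} {y} eq =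
  trans (sym (swap-involutive a b x)) (trans (cong (swap a b) eq) (swap-involutive a b y))

-- Labels are made canonical in the order in which they are met. A letter `y` not below `m` is new:
-- exchanging it with `m` gives it its canonical label and leaves the labels below `m` alone, and
-- every later exchange fixes `m`.
relabel : ∀ r m (u : Vec ℕ n) → ∃[ ρ ] ∃[ c ]
  (Injective _≡_ _≡_ ρ × (∀ {e} → e < m → ρ e ≡ e) × RGSFrom m c × map ρ u ≡ arrange r m c)
relabel {zero} r m [] = (λ x → x) , [] , (λ eq → eq) , (λ _ → refl) , [] , refl
relabel {suc n} r m u with uninsert (m <ᵇ r) u
... | y , u′ , refl with y <? m
...   | yes y<m with ρ , c , inj , fix , rc , eq ← relabel r m u′ =
  ρ , y ∷ c , inj , fix , <⇒≤ y<m ∷ subst (λ k → RGSFrom k c) (sym m≡) rc ,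
  trans (map-insert ρ (m <ᵇ r) y u′)
    (cong₂ (insert (m <ᵇ r)) (fix y<m) (trans eq (cong (λ k → arrange r k c) (sym m≡))))
  where
  m≡ : m ⊔ suc y ≡ m
  m≡ = m≥n⇒m⊔n≡m y<m
...   | no  y≮m with ρ , c , inj , fix , rc , eq ← relabel r (suc m) (map (swap m y) u′) =
  ρ ∘ swap m y , m ∷ c ,
  (λ h → swap-injective m y (inj h)) ,
  (λ {e} e<m → trans (cong ρ (swap-other (<⇒≢ e<m) λ e≡y → y≮m (subst (_< m) e≡y e<m)))
                     (fix (m<n⇒m<1+n e<m))) ,
  ≤-refl ∷ subst (λ k → RGSFrom k c) (sym m≡) rc ,
  trans (map-insert (ρ ∘ swap m y) (m <ᵇ r) y u′)
    (cong₂ (insert (m <ᵇ r))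
      (trans (cong ρ (swap-right m y)) (fix ≤-refl))
      (trans (map-∘ ρ (swap m y) u′) (trans eq (cong (λ k → arrange r k c) (sym m≡)))))
  where
  m≡ : m ⊔ suc m ≡ suc m
  m≡ = m≤n⇒m⊔n≡n (n≤1+n m)

arrange-exists : ∀ r (u : Vec ℕ n) → ∃[ c ] (IsRGS c × SameKernel u (arrange r 0 c))
arrange-exists r u with ρ , c , inj , _ , rc , eq ← relabel r 0 u =
  c , rc , subst (SameKernel u) eq (sameKernel-map inj u)

arrange-from-left : ∀ {r m} → r ≤ m → (c : Vec ℕ n) → arrange r m c ≡ c
arrange-from-left r≤m [] = refl
arrange-from-left {r = r} {m} r≤m (x ∷ c) with m <ᵇ r in eq
... | true  = contradiction (<ᵇ⇒< m r (subst T (sym eq) _)) (≤⇒≯ r≤m)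
... | false = cong (x ∷_) (arrange-from-left (≤-trans r≤m (m≤m⊔n m (suc x))) c)

arrange-all : ∀ (P : ℕ → Set) r m (c : Vec ℕ n) → (∀ i → P (lookup c i)) →
              ∀ i → P (lookup (arrange r m c) i)
arrange-all P r m [] pc ()
arrange-all P r m (x ∷ c) pc i with m <ᵇ r
... | false = go i
  where
  go : ∀ i → P (lookup (x ∷ arrange r (m ⊔ suc x) c) i)
  go zero    = pc zero
  go (suc i) = arrange-all P r (m ⊔ suc x) c (pc ∘ suc) i
... | true = go (arrange r (m ⊔ suc x) c) (arrange-all P r (m ⊔ suc x) c (pc ∘ suc)) i
  where
  go : ∀ {n} (v : Vec ℕ n) → (∀ i → P (lookup v i)) → ∀ i → P (lookup (v ∷ʳᵛ x) i)
  go []      pv zero    = pc zero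
  go (y ∷ v) pv zero    = pv zero
  go (y ∷ v) pv (suc i) = go v (pv ∘ suc) i

-- The restriction imposed by avoidance

interval : ℕ → ℕ → List ℕ
interval a zero    = []
interval a (suc d) = a ∷ interval (suc a) d

interval-++ : ∀ a d e → interval a (d + e) ≡ interval a d ++ interval (a + d) e
interval-++ a zero    e = cong (λ b → interval b e) (sym (+-identityʳ a))
interval-++ a (suc d) e = cong (a ∷_) (trans (interval-++ (suc a) d e)
  (cong (λ b → interval (suc a) d ++ interval b e) (sym (+-suc a d))))

interval-⊆ : ∀ {a d b e} → b ≤ a → a + d ≤ b + e → interval a d ⊆ interval b e
interval-⊆ {a} {zero}  {b} {e}     b≤a le = minimum _
interval-⊆ {a} {suc d} {b} {zero}  b≤a le = contradiction
  (≤-trans (≤-<-trans b≤a (m<m+n a z<s)) (subst (a + suc d ≤_) (+-identityʳ b) le)) (<-irrefl refl)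
interval-⊆ {a} {suc d} {b} {suc e} b≤a le with m≤n⇒m<n∨m≡n b≤a
... | inj₁ b<a  = b ∷ʳ interval-⊆ b<a (subst (a + suc d ≤_) (+-suc b e) le)
... | inj₂ refl = refl ∷ interval-⊆ ≤-refl (subst₂ _≤_ (+-suc a d) (+-suc a e) le)

length-interval : ∀ a d → length (interval a d) ≡ d
length-interval a zero    = refl
length-interval a (suc d) = cong suc (length-interval (suc a) d)

interval-all : ∀ {P : ℕ → Set} a d → (∀ {x} → a ≤ x → x < a + d → P x) → All P (interval a d)
interval-all a zero    P! = []
interval-all a (suc d) P! = P! ≤-refl (m<m+n a z<s) ∷
  interval-all (suc a) d (λ {x} a< x< → P! (<⇒≤ a<) (subst (x <_) (sym (+-suc a d)) x<))

downFrom-all : ∀ {P : ℕ → Set} m → (∀ {x} → x < m → P x) → All P (downFrom m)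
downFrom-all zero    P! = []
downFrom-all (suc m) P! = P! ≤-refl ∷ downFrom-all m (P! ∘ m<n⇒m<1+n)

-- With m blocks open, a letter x ≥ b must be the label of a new block or of one of the q latest blocks.
data Windowed (b q : ℕ) : ℕ → Vec ℕ n → Set where
  []  : Windowed b q m []
  _∷_ : ∀ {x} {xs : Vec ℕ n} → x ≤ m × (x < b ⊎ m ≤ x + q) →
        Windowed b q (m ⊔ suc x) xs → Windowed b q m (x ∷ xs)

windowed⇒rgs : ∀ {b q} {c : Vec ℕ n} → Windowed b q m c → RGSFrom m c
windowed⇒rgs []              = []
windowed⇒rgs ((x≤m , _) ∷ w) = x≤m ∷ windowed⇒rgs w

module _ (p q r : ℕ) where

  -- A copy of δ doubling the label `x`. The labels 0, ..., r - 1 are met from the right, so from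
  -- left to right they appear in decreasing order; labels from r on are opened from the left in
  -- increasing order.
  pattern-at : ℕ → List ℕ
  pattern-at x = interval r p ++ x ∷ interval (suc x) q ++ x ∷ downFrom r

  Occurs : List ℕ → Set
  Occurs w = ∃[ x ] (r + p ≤ x × pattern-at x ⊆ w)

  -- Second phase: `pre` and `suf` are the parts already read at the left and right ends, and `c` is
  -- what remains between them. A letter outside the window would complete a pattern from `pre`,
  -- itself and `suf`.
  ¬occurs⇒windowedˡ : ∀ {m} pre suf (c : Vec ℕ n) → RGSFrom m c → r ≤ m →
    interval r (m ∸ r) ⊆ pre → downFrom r ⊆ suf →
    ¬ Occurs (pre ++ toList c ++ suf) → Windowed (r + p) q m c
  ¬occurs⇒windowedˡ pre suf [] _ _ _ _ _ = []
  ¬occurs⇒windowedˡ {m = m} pre suf (x ∷ c) (x≤m ∷ rc) r≤m ⊆pre ⊆suf avoid =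
    (x≤m , window) ∷ ¬occurs⇒windowedˡ (pre ++ [ x ]) suf c rc
      (≤-trans r≤m (m≤m⊔n m (suc x))) opened ⊆suf
      (avoid ∘ subst Occurs (++-assoc pre [ x ] (toList c ++ suf)))
    where
    window : x < r + p ⊎ m ≤ x + q
    window with x <? r + p | m ≤? x + q
    ... | yes x<b | _       = inj₁ x<b
    ... | no _    | yes m≤  = inj₂ m≤
    ... | no x≮b  | no m≰   = contradiction (x , b≤x , occ) avoid
      where
      b≤x : r + p ≤ x
      b≤x = ≮⇒≥ x≮b

      x+q<m : x + suc q ≤ m
      x+q<m = subst (_≤ m) (sym (+-suc x q)) (≰⇒> m≰)

      e = m ∸ (r + p)

      b≤m : r + p ≤ m
      b≤m = ≤-trans b≤x x≤m

      split : interval r (m ∸ r) ≡ interval r p ++ interval (r + p) e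
      split = trans (cong (interval r) (sym eq)) (interval-++ r p e)
        where
        eq : p + e ≡ m ∸ r
        eq = trans (sym (m+n∸m≡n r (p + e)))
               (cong (_∸ r) (trans (sym (+-assoc r p e)) (m+[n∸m]≡n b≤m)))

      -- Since x + q < m, the labels x, ..., x + q are already open and occur in `pre` in this
      -- order, after r, ..., r + p - 1. The letter being read is the second `x`.
      before : interval r p ++ interval x (suc q) ⊆ pre
      before = ⊆-trans (++⁺ ⊆-refl (interval-⊆ b≤x
                 (subst (x + suc q ≤_) (sym (m+[n∸m]≡n b≤m)) x+q<m)))
               (subst (_⊆ pre) split ⊆pre)

      occ : pattern-at x ⊆ pre ++ x ∷ toList c ++ suf
      occ = subst (_⊆ _) (++-assoc (interval r p) _ _)
              (++⁺ before (refl ∷ ++⁺ˡ (toList c) ⊆suf))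

    opened : interval r ((m ⊔ suc x) ∸ r) ⊆ pre ++ [ x ]
    opened with m≤n⇒m<n∨m≡n x≤m
    ... | inj₁ x<m rewrite m≥n⇒m⊔n≡m x<m = ++⁺ʳ [ x ] ⊆pre
    ... | inj₂ refl rewrite m≤n⇒m⊔n≡n (n≤1+n x) =
      subst (_⊆ pre ++ [ x ]) (sym eq) (++⁺ ⊆pre ⊆-refl)
      where
      eq : interval r (suc x ∸ r) ≡ interval r (x ∸ r) ++ [ x ]
      eq = trans (cong (interval r) (trans (+-∸-assoc 1 r≤m) (+-comm 1 (x ∸ r))))
             (trans (interval-++ r (x ∸ r) 1)
               (cong (λ y → interval r (x ∸ r) ++ [ y ]) (m+[n∸m]≡n r≤m)))

  -- First phase: letters move from the right end into `suf`, and each is at most m < r, hence below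
  -- the threshold of the window. Once m = r the second phase takes over with an empty `pre`,
  -- nothing having been read from the left.
  ¬occurs⇒windowed : ∀ {m} suf (c : Vec ℕ n) → RGSFrom m c → m ≤ r → downFrom m ⊆ suf →
    ¬ Occurs (toList (arrange r m c) ++ suf) → Windowed (r + p) q m c
  ¬occurs⇒windowed suf [] _ _ _ _ = []
  ¬occurs⇒windowed {m = m} suf (x ∷ c) (x≤m ∷ rc) m≤r ⊆suf avoid
    with m≤n⇒m<n∨m≡n m≤r
  ... | inj₂ refl = ¬occurs⇒windowedˡ [] suf (x ∷ c) (x≤m ∷ rc) ≤-refl
    (subst (λ d → interval m d ⊆ []) (sym (n∸n≡0 m)) []) ⊆suf
    (subst (λ v → ¬ Occurs (toList v ++ suf)) (arrange-from-left {r = m} ≤-refl (x ∷ c)) avoid)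
  ... | inj₁ m<r with m <ᵇ r in eq
  ...   | false = contradiction (<⇒<ᵇ m<r) (subst T eq)
  ...   | true  = (x≤m , inj₁ (≤-<-trans x≤m (<-≤-trans m<r (m≤m+n r p)))) ∷
    ¬occurs⇒windowed (x ∷ suf) c rc (⊔-lub m≤r (≤-<-trans x≤m m<r)) met
      (subst (λ w → ¬ Occurs w) list≡ avoid)
    where
    v = arrange r (m ⊔ suc x) c

    list≡ : toList (v ∷ʳᵛ x) ++ suf ≡ toList v ++ x ∷ suf
    list≡ = trans (cong (_++ suf) (toList-∷ʳ x v)) (++-assoc (toList v) [ x ] suf)

    met : downFrom (m ⊔ suc x) ⊆ x ∷ suf
    met with m≤n⇒m<n∨m≡n x≤m
    ... | inj₁ x<m rewrite m≥n⇒m⊔n≡m x<m = x ∷ʳ ⊆suf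
    ... | inj₂ refl rewrite m≤n⇒m⊔n≡n (n≤1+n x) = refl ∷ ⊆suf

-- Reduction of labels modulo q + 1

m%n≡o%n∧m/n<o/n⇒m+n≤o : ∀ {m o} n .{{_ : NonZero n}} → m % n ≡ o % n → m / n < o / n → m + n ≤ o
m%n≡o%n∧m/n<o/n⇒m+n≤o {m} {o} n eq lt = begin
  m + n                       ≡⟨ cong (_+ n) (m≡m%n+[m/n]*n m n) ⟩
  m % n + m / n * n + n       ≡⟨ +-assoc (m % n) (m / n * n) n ⟩
  m % n + (m / n * n + n)     ≡⟨ cong₂ _+_ eq (+-comm (m / n * n) n) ⟩
  o % n + suc (m / n) * n     ≤⟨ +-monoʳ-≤ (o % n) (*-monoˡ-≤ n lt) ⟩
  o % n + o / n * n           ≡⟨ m≡m%n+[m/n]*n o n ⟨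
  o                           ∎
  where open ≤-Reasoning

m%n≡o%n⇒m≡o : ∀ {m o} n .{{_ : NonZero n}} → m < o + n → o < m + n → m % n ≡ o % n → m ≡ o
m%n≡o%n⇒m≡o {m} {o} n m< o< eq with <-cmp (m / n) (o / n)
... | tri≈ _ eq/ _ = trans (m≡m%n+[m/n]*n m n)
        (trans (cong₂ (λ a b → a + b * n) eq eq/) (sym (m≡m%n+[m/n]*n o n)))
... | tri< lt _ _ = contradiction o< (≤⇒≯ (m%n≡o%n∧m/n<o/n⇒m+n≤o n eq lt))
... | tri> _ _ gt = contradiction m< (≤⇒≯ (m%n≡o%n∧m/n<o/n⇒m+n≤o n (sym eq) gt))

module _ (b q : ℕ) where

  -- Injective on each set of letters that Windowed allows: below b it is the identity, and the
  -- allowed letters from b on lie in an interval of suc q integers.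
  fold : ℕ → ℕ
  fold x with x <? b
  ... | yes _ = x
  ... | no  _ = b + (x ∸ b) % suc q

  fold-< : ∀ x → fold x < b + suc q
  fold-< x with x <? b
  ... | yes x<b = <-≤-trans x<b (m≤m+n b (suc q))
  ... | no  _   = +-monoʳ-< b (m%n<n (x ∸ b) (suc q))

  fold-≤ : ∀ x → fold x ≤ x
  fold-≤ x with x <? b
  ... | yes _   = ≤-refl
  ... | no  x≮b = subst (b + (x ∸ b) % suc q ≤_) (m+[n∸m]≡n (≮⇒≥ x≮b))
                    (+-monoʳ-≤ b (m%n≤m (x ∸ b) (suc q)))

  fold-id : ∀ {x} → x < b + suc q → fold x ≡ x
  fold-id {x} x<K with x <? b
  ... | yes _   = refl
  ... | no  x≮b = trans (cong (b +_) (m<n⇒m%n≡m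
                    (+-cancelˡ-< b _ _ (subst (_< b + suc q) (sym b+) x<K)))) b+
    where
    b+ : b + (x ∸ b) ≡ x
    b+ = m+[n∸m]≡n (≮⇒≥ x≮b)

  fold-injective : ∀ {m x y} → x ≤ m × (x < b ⊎ m ≤ x + q) → y ≤ m × (y < b ⊎ m ≤ y + q) →
                   fold x ≡ fold y → x ≡ y
  fold-injective {m} {x} {y} (x≤m , wx) (y≤m , wy) eq with x <? b | y <? b
  ... | yes _   | yes _   = eq
  ... | yes x<b | no _    = contradiction (subst (_< b) eq x<b) (≤⇒≯ (m≤m+n b _))
  ... | no _    | yes y<b = contradiction (subst (_< b) (sym eq) y<b) (≤⇒≯ (m≤m+n b _))
  ... | no x≮b  | no y≮b  = ∸-cancelʳ-≡ (≮⇒≥ x≮b) (≮⇒≥ y≮b)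
    (m%n≡o%n⇒m≡o (suc q) (close x≤m y≮b wy) (close y≤m x≮b wx) (+-cancelˡ-≡ b _ _ eq))
    where
    close : ∀ {x y} → x ≤ m → ¬ y < b → y < b ⊎ m ≤ y + q → x ∸ b < y ∸ b + suc q
    close _ y≮b (inj₁ y<b) = contradiction y<b y≮b
    close {x} {y} x≤m y≮b (inj₂ m≤) = begin-strict
      x ∸ b             ≤⟨ ∸-monoˡ-≤ b (≤-trans x≤m m≤) ⟩
      y + q ∸ b         ≡⟨ +-∸-comm q (≮⇒≥ y≮b) ⟩
      y ∸ b + q         <⟨ +-monoʳ-< (y ∸ b) (n<1+n q) ⟩
      y ∸ b + suc q     ∎
      where open ≤-Reasoning

  -- Equal folds under a common window force equal letters, so both words again have the same number
  -- of open blocks and the next window is common too.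
  fold-word-injective : {c d : Vec ℕ n} → Windowed b q m c → Windowed b q m d →
                        map fold c ≡ map fold d → c ≡ d
  fold-word-injective [] [] _ = refl
  fold-word-injective (wx ∷ wc) (wy ∷ wd) eq
    with refl ← fold-injective wx wy (cong head eq) =
    cong (_ ∷_) (fold-word-injective wc wd (cong tail eq))

  -- A letter below b + q + 1 is unchanged. A larger one can occur only when all b + q + 1 reduced
  -- labels are already open, and it is folded onto one of them.
  fold-word-rgs : ∀ {m} {c : Vec ℕ n} → RGSFrom m c → RGSFrom (m ⊓ (b + suc q)) (map fold c)
  fold-word-rgs [] = []
  fold-word-rgs {m = m} {x ∷ c} (x≤m ∷ rc) =
    ⊓-glb (≤-trans (fold-≤ x) x≤m) (<⇒≤ (fold-< x)) ∷
    subst (λ j → RGSFrom j (map fold c)) eq (fold-word-rgs rc)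
    where
    K = b + suc q
    eq : (m ⊔ suc x) ⊓ K ≡ (m ⊓ K) ⊔ suc (fold x)
    eq with x <? K
    ... | yes x<K = trans (⊓-distribʳ-⊔ K m (suc x))
                      (cong ((m ⊓ K) ⊔_) (trans (m≤n⇒m⊓n≡m x<K) (cong suc (sym (fold-id x<K)))))
    ... | no  x≮K = trans (m≥n⇒m⊓n≡n (≤-trans K≤m (m≤m⊔n m (suc x))))
                      (sym (trans (cong (_⊔ suc (fold x)) (m≥n⇒m⊓n≡n K≤m)) (m≥n⇒m⊔n≡m (fold-< x))))
      where
      K≤m : K ≤ m
      K≤m = ≤-trans (≮⇒≥ x≮K) x≤m

-- One-doubleton patterns

-- Fixing the two positions numerically determines the kernel, and taking a function lets the notion
-- serve both vectors and lists.
Doubleton : (p q : ℕ) → (Fin k → ℕ) → Set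
Doubleton p q f =
  (∀ a b → toℕ a ≡ p → toℕ b ≡ p + suc q → f a ≡ f b) ×
  (∀ a b → a <ᶠ b → f a ≡ f b → toℕ a ≡ p × toℕ b ≡ p + suc q)

doubleton-kernel : ∀ {p q} {f g : Fin k → ℕ} → Doubleton p q f → Doubleton p q g →
                   ∀ a b → f a ≡ f b → g a ≡ g b
doubleton-kernel {g = g} (_ , f-only) (g-eq , _) a b eq with Fin.<-cmp a b
... | tri< a<b _ _ = let a≡ , b≡ = f-only a b a<b eq in g-eq a b a≡ b≡
... | tri≈ _ a≡b _ = cong g a≡b
... | tri> _ _ b<a = let b≡ , a≡ = f-only b a b<a (sym eq) in sym (g-eq b a b≡ a≡)

oneDoubleton⇒doubleton : (δ : Vec ℕ k) → OneDoubleton δ →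
  ∃[ p ] ∃[ q ] ∃[ r ] (k ≡ p + suc (q + suc r) × Doubleton p q (lookup δ))
oneDoubleton⇒doubleton {k} δ (i , j , i<j , eq , only)
  -- The gaps i + 1 + q = j and j + 1 + r = k count the singletons between and after the doubleton.
  with q , q≡ ← m≤n⇒∃[o]m+o≡n i<j | r , r≡ ← m≤n⇒∃[o]m+o≡n (Fin.toℕ<n j) =
  toℕ i , q , r , k≡ , at , unique
  where
  j≡ : toℕ j ≡ toℕ i + suc q
  j≡ = trans (sym q≡) (sym (+-suc (toℕ i) q))

  k≡ : k ≡ toℕ i + suc (q + suc r)
  k≡ = trans (sym r≡) (trans (cong (λ x → suc x + r) j≡) (shift (toℕ i) q r))
    where
    shift : ∀ p q r → suc (p + suc q) + r ≡ p + suc (q + suc r)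
    shift = solve-∀

  at : ∀ a b → toℕ a ≡ toℕ i → toℕ b ≡ toℕ i + suc q → lookup δ a ≡ lookup δ b
  at a b a≡ b≡ = trans (cong (lookup δ) (Fin.toℕ-injective a≡))
    (trans eq (cong (lookup δ) (Fin.toℕ-injective (trans j≡ (sym b≡)))))

  unique : ∀ a b → a <ᶠ b → lookup δ a ≡ lookup δ b → toℕ a ≡ toℕ i × toℕ b ≡ toℕ i + suc q
  unique a b a<b eq with only a b (λ a≡b → <⇒≢ a<b (cong toℕ a≡b)) eq
  ... | inj₁ (refl , refl) = refl , j≡
  ... | inj₂ (refl , refl) = contradiction i<j (<-asym a<b)

lookup-injective : ∀ {A : Set} {xs : List A} → Unique xs → ∀ i j →
                   List.lookup xs i ≡ List.lookup xs j → i ≡ j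
lookup-injective (_  ∷ _) zero    zero    _  = refl
lookup-injective (x∉ ∷ _) zero    (suc j) eq = contradiction eq (All.lookup x∉ (∈-lookup j))
lookup-injective (x∉ ∷ _) (suc i) zero    eq = contradiction (sym eq) (All.lookup x∉ (∈-lookup i))
lookup-injective (_  ∷ u) (suc i) (suc j) eq = cong suc (lookup-injective u i j eq)

index-middle : ∀ (xs : List ℕ) x ys → ∃[ c ] (toℕ c ≡ length xs × List.lookup (xs ++ x ∷ ys) c ≡ x)
index-middle []       x ys = zero , refl , refl
index-middle (y ∷ xs) x ys = let c , c≡ , eq = index-middle xs x ys in suc c , cong suc c≡ , eq

-- The tail has no repetition, so the only coincidence is between the head and its single occurrence
-- in the tail.
doubleton-head : ∀ xs x ys → Unique (xs ++ x ∷ ys) →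
                 Doubleton 0 (length xs) (List.lookup (x ∷ xs ++ x ∷ ys))
doubleton-head xs x ys u with c , c≡ , eq ← index-middle xs x ys = at , only
  where
  l = x ∷ xs ++ x ∷ ys

  at : ∀ a b → toℕ a ≡ 0 → toℕ b ≡ suc (length xs) → List.lookup l a ≡ List.lookup l b
  at zero (suc b) _ b≡ = trans (sym eq) (cong (List.lookup (xs ++ x ∷ ys))
    (Fin.toℕ-injective (trans c≡ (sym (suc-injective b≡)))))

  only : ∀ a b → a <ᶠ b → List.lookup l a ≡ List.lookup l b → toℕ a ≡ 0 × toℕ b ≡ suc (length xs)
  only zero    (suc b) _         eq′ = refl , cong suc (trans
    (cong toℕ (lookup-injective u b c (trans (sym eq′) (sym eq)))) c≡)
  only (suc a) (suc b) (s≤s a<b) eq′ =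
    contradiction (cong toℕ (lookup-injective u a b eq′)) (<⇒≢ a<b)

doubleton-∷ : ∀ {p q x l} → All (x ≢_) l → Doubleton p q (List.lookup l) →
              Doubleton (suc p) q (List.lookup (x ∷ l))
doubleton-∷ {p} {q} {x} {l} x∉ (at , only) = at′ , only′
  where
  at′ : ∀ a b → toℕ a ≡ suc p → toℕ b ≡ suc p + suc q → List.lookup (x ∷ l) a ≡ List.lookup (x ∷ l) b
  at′ (suc a) (suc b) a≡ b≡ = at a b (suc-injective a≡) (suc-injective b≡)

  only′ : ∀ a b → a <ᶠ b → List.lookup (x ∷ l) a ≡ List.lookup (x ∷ l) b →
          toℕ a ≡ suc p × toℕ b ≡ suc p + suc q
  only′ zero    (suc b) _         eq = contradiction eq (All.lookup x∉ (∈-lookup b))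
  only′ (suc a) (suc b) (s≤s a<b) eq = let a≡ , b≡ = only a b a<b eq in cong suc a≡ , cong suc b≡

Outside : (a d : ℕ) → ℕ → Set
Outside a d x = x < a ⊎ a + d ≤ x

outside-head : ∀ {a d x} → Outside a (suc d) x → a ≢ x
outside-head         (inj₁ x<a) a≡x = <⇒≢ x<a (sym a≡x)
outside-head {a} {d} (inj₂ le)  a≡x = <⇒≢ (<-≤-trans (m<m+n a z<s) le) a≡x

outside-tail : ∀ {a d x} → Outside a (suc d) x → Outside (suc a) d x
outside-tail         (inj₁ x<a) = inj₁ (m<n⇒m<1+n x<a)
outside-tail {a} {d} {x} (inj₂ le)  = inj₂ (subst (_≤ x) (+-suc a d) le)

doubleton-interval : ∀ {a p q l} → All (Outside a p) l → Doubleton 0 q (List.lookup l) →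
                     Doubleton p q (List.lookup (interval a p ++ l))
doubleton-interval {p = zero}  out d = d
doubleton-interval {a} {suc p} out d =
  doubleton-∷ (All.++⁺ (interval-all (suc a) p (λ a< _ → <⇒≢ a<)) (All.map outside-head out))
    (doubleton-interval (All.map outside-tail out) d)

unique-interval : ∀ {a d l} → All (Outside a d) l → Unique l → Unique (interval a d ++ l)
unique-interval {d = zero}      out u = u
unique-interval {a} {suc d} out u =
  All.++⁺ (interval-all (suc a) d (λ a< _ → <⇒≢ a<)) (All.map outside-head out) ∷
  unique-interval (All.map outside-tail out) u

doubleton-between : ∀ {x a q ys} → All (Outside a q) (x ∷ ys) → Unique (x ∷ ys) →
                    Doubleton 0 q (List.lookup (x ∷ interval a q ++ x ∷ ys))
doubleton-between {x} {a} {q} {ys} out u =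
  subst (λ j → Doubleton 0 j (List.lookup (x ∷ interval a q ++ x ∷ ys))) (length-interval a q)
    (doubleton-head (interval a q) x ys (unique-interval out u))

unique-∷-downFrom : ∀ {x m} → m ≤ x → Unique (x ∷ downFrom m)
unique-∷-downFrom {x} {m} m≤x =
  downFrom-all m (λ y<m → >⇒≢ (<-≤-trans y<m m≤x)) ∷ Unique.downFrom⁺ m

pattern-doubleton : ∀ p q r {x} → r + p ≤ x → Doubleton p q (List.lookup (pattern-at p q r x))
pattern-doubleton p q r {x} b≤x =
  doubleton-interval (inj₂ b≤x ∷ All.++⁺ (interval-all (suc x) q (λ x< _ → inj₂ (≤-trans b≤x (<⇒≤ x<))))
                                  (inj₂ b≤x ∷ downFrom-all r inj₁))
    (doubleton-between (inj₁ ≤-refl ∷ downFrom-all r (λ y<r → inj₁ (<-trans y<r (s≤s r≤x))))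
      (unique-∷-downFrom r≤x))
  where
  r≤x : r ≤ x
  r≤x = ≤-trans (m≤m+n r p) b≤x

pattern-length : ∀ p q r x → length (pattern-at p q r x) ≡ p + suc (q + suc r)
pattern-length p q r x
  rewrite length-++ (interval r p) {x ∷ interval (suc x) q ++ x ∷ downFrom r}
        | length-++ (interval (suc x) q) {x ∷ downFrom r}
        | length-interval r p | length-interval (suc x) q | length-downFrom r = refl

embed : ∀ {l} (w : Vec ℕ n) → l ⊆ toList w →
  Σ (Fin (length l) → Fin n) λ f → (∀ i j → i <ᶠ j → f i <ᶠ f j) ×
    (∀ i → lookup w (f i) ≡ List.lookup l i)
embed []      []         = (λ ()) , (λ ()) , λ ()
embed (y ∷ w) (.y ∷ʳ s)  = let f , mono , eq = embed w s in
  suc ∘ f , (λ i j i<j → s<s (mono i j i<j)) , eq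
embed {l = x ∷ l} (y ∷ w) (refl ∷ s) with f , mono , eq ← embed w s = f′ , mono′ , eq′
  where
  f′ : Fin (suc (length l)) → Fin _
  f′ zero    = zero
  f′ (suc i) = suc (f i)

  mono′ : ∀ i j → i <ᶠ j → f′ i <ᶠ f′ j
  mono′ zero    (suc j) _         = z<s
  mono′ (suc i) (suc j) (s≤s i<j) = s<s (mono i j i<j)

  eq′ : ∀ i → lookup (x ∷ w) (f′ i) ≡ List.lookup (x ∷ l) i
  eq′ zero    = refl
  eq′ (suc i) = eq i

-- Having their doubletons at the same positions, `l` and `δ` have the same kernel; the embedding of
-- `l` into `w` supplies the increasing map.
sublist⇒contains : ∀ {p q l} {w : Vec ℕ n} {δ : Vec ℕ k} → length l ≡ k →
  Doubleton p q (List.lookup l) → Doubleton p q (lookup δ) → l ⊆ toList w → Contains w δ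
sublist⇒contains {w = w} refl dl dδ s with f , mono , eq ← embed w s =
  f , mono , λ i j → mk⇔
    (λ h → doubleton-kernel dl dδ i j (trans (sym (eq i)) (trans h (eq j))))
    (λ h → trans (eq i) (trans (doubleton-kernel dδ dl i j h) (sym (eq j))))

module _ {b q : ℕ} where

  windowed-old : ∀ {m x L} → x < m → x < b ⊎ m ≤ x + q →
                 Windowed b q m (fromList L) → Windowed b q m (fromList (x ∷ L))
  windowed-old {L = L} x<m win w = (<⇒≤ x<m , win) ∷
    subst (λ j → Windowed b q j (fromList L)) (sym (m≥n⇒m⊔n≡m x<m)) w

  windowed-new : ∀ {m L} → Windowed b q (suc m) (fromList L) → Windowed b q m (fromList (m ∷ L))
  windowed-new {m} {L} w = (≤-refl , inj₂ (m≤m+n m q)) ∷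
    subst (λ j → Windowed b q j (fromList L)) (sym (m≤n⇒m⊔n≡n (n≤1+n m))) w

  windowed-interval : ∀ m d {L} → Windowed b q (m + d) (fromList L) →
                      Windowed b q m (fromList (interval m d ++ L))
  windowed-interval m zero    {L} w = subst (λ j → Windowed b q j (fromList L)) (+-identityʳ m) w
  windowed-interval m (suc d) {L} w = windowed-new
    (windowed-interval (suc m) d (subst (λ j → Windowed b q j (fromList L)) (+-suc m d) w))

  -- Repeated zeros are the padding that brings a missed word to the required length.
  windowed-zeros : ∀ {m} d {L} → 0 < m → 0 < b ⊎ m ≤ q → Windowed b q m (fromList L) →
                   Windowed b q m (fromList (replicate d 0 ++ L))
  windowed-zeros zero    0<m win w = w
  windowed-zeros (suc d) 0<m win w = windowed-old 0<m win (windowed-zeros d 0<m win w)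

-- The letters m, ..., r - 1 are met while fewer than `r` labels are known, so they go to the right
-- end in reverse order; then `L` is laid out from the left.
arrange-interval : ∀ {r} m d L → m + d ≡ r →
  toList (arrange r m (fromList (interval m d ++ L))) ++ downFrom m ≡ L ++ downFrom r
arrange-interval {r} m zero L eq rewrite +-identityʳ m | eq =
  cong (_++ downFrom r) (trans (cong toList (arrange-from-left {r = r} ≤-refl (fromList L))) (toList∘fromList L))
arrange-interval {r} m (suc d) L eq with m <ᵇ r in lt
... | false = contradiction (<⇒<ᵇ (subst (m <_) eq (m<m+n m z<s))) (subst T lt)
... | true  = trans (cong (_++ downFrom m) (toList-∷ʳ m v))
               (trans (++-assoc (toList v) [ m ] (downFrom m))
                 (trans (cong (λ j → toList (arrange r j (fromList w)) ++ downFrom (suc m))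
                              (m≤n⇒m⊔n≡n (n≤1+n m)))
                   (arrange-interval (suc m) d L (trans (sym (+-suc m d)) eq))))
  where
  w = interval (suc m) d ++ L
  v = arrange r (m ⊔ suc m) (fromList w)

-- Words missed by the reduction

-- A reading order fixed by fold although its word contains the pattern.
Witness : (p q r n : ℕ) → Set
Witness p q r n = Σ (Vec ℕ n) λ c → (Windowed (r + p) q 0 c × (∀ i → lookup c i < r + p + suc q) ×
  ∃[ l ] (length l ≡ p + suc (q + suc r) × Doubleton p q (List.lookup l) ×
          l ⊆ toList (arrange r 0 c)))

-- The reading order starts with 0, ..., r - 1, which end up at the right of the word, so only the
-- part `L` read from the left has to be chosen.
mkWitness : ∀ {p q r n} L l → n ≡ r + length L → Windowed (r + p) q r (fromList L) →
  All (_< r + p + suc q) L → length l ≡ p + suc (q + suc r) → Doubleton p q (List.lookup l) →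
  l ⊆ L ++ downFrom r → Witness p q r n
mkWitness {p} {q} {r} {n} L l n≡ win all len dbl sub =
  subst (Witness p q r) (sym n≡′)
    (fromList c , windowed-interval 0 r win ,
     VecAll.lookup⁺ (VecAll.fromList⁺ (All.++⁺ (interval-all 0 r λ _ x<r → <-≤-trans x<r r≤K) all)) ,
     l , len , dbl , subst (l ⊆_) (sym list≡) sub)
  where
  c = interval 0 r ++ L

  r≤K : r ≤ r + p + suc q
  r≤K = ≤-trans (m≤m+n r p) (m≤m+n (r + p) (suc q))

  n≡′ : n ≡ length c
  n≡′ = trans n≡ (sym (trans (length-++ (interval 0 r)) (cong (_+ length L) (length-interval 0 r))))

  list≡ : toList (arrange r 0 (fromList c)) ≡ L ++ downFrom r
  list≡ = trans (sym (++-identityʳ _)) (arrange-interval 0 r L refl)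

-- The doubled label must be one that may recur: it is r, the first of the p labels, if p > 0, else
-- r - 1, the last of the r labels, if r > 0, else 1, which is among the q latest while at most
-- q + 1 blocks are open; there, 0 recurring between the two 1s supplies the missing q-th block.
witness : ∀ p q r d → 2 ≤ p + (q + r) → Witness p q r (suc (p + suc (q + suc r)) + d)
witness (suc p) q r d _ = mkWitness L l len≡ win all len dbl sub
  where
  b = r + suc p
  M = replicate d 0 ++ r ∷ interval (suc b) q ++ [ r ]
  L = interval r (suc (suc p)) ++ M
  -- The copy skips the first letter `r` of `L`, which serves only to open that block. Its leading
  -- singletons are thus r + 1, ..., b, and both doubled letters `r` come after them.
  l = interval (suc r) (suc p) ++ r ∷ interval (suc b) q ++ r ∷ downFrom r

  len≡ : suc (suc p + suc (q + suc r)) + d ≡ r + length L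
  len≡ rewrite length-++ (interval r (suc (suc p))) {M}
             | length-++ (replicate d 0) {r ∷ interval (suc b) q ++ [ r ]}
             | length-++ (interval (suc b) q) {[ r ]}
             | length-interval (suc (suc r)) p | length-interval (suc b) q | length-replicate d {0}
             = arith p q r d
    where
    arith : ∀ p q r d → suc (suc p + suc (q + suc r)) + d ≡ r + (suc (suc p) + (d + suc (q + 1)))
    arith = solve-∀

  r<b : r < b
  r<b = m<m+n r z<s

  win : Windowed b q r (fromList L)
  win = windowed-interval r (suc (suc p)) (subst (λ j → Windowed b q j (fromList M)) (sym (+-suc r (suc p)))
    (windowed-zeros d z<s (inj₁ (≤-<-trans z≤n r<b))
      (windowed-old (m<n⇒m<1+n r<b) (inj₁ r<b)
        (windowed-interval (suc b) q
          (windowed-old (<-≤-trans r<b (≤-trans (n≤1+n b) (m≤m+n (suc b) q))) (inj₁ r<b) [])))))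

  all : All (_< b + suc q) L
  all = All.++⁺ (interval-all r (suc (suc p)) λ {x} _ x< → <-≤-trans x<
            (subst (_≤ b + suc q) (sym (+-suc r (suc p))) (m<m+n b z<s)))
        (All.++⁺ (All.replicate⁺ d (≤-<-trans z≤n (m<m+n b z<s)))
          (r<K ∷ All.++⁺ (interval-all (suc b) q λ {x} _ x< → subst (x <_) (sym (+-suc b q)) x<) (r<K ∷ [])))
    where
    r<K : r < b + suc q
    r<K = <-trans r<b (m<m+n b z<s)

  len : length l ≡ suc p + suc (q + suc r)
  len rewrite length-++ (interval (suc r) (suc p)) {r ∷ interval (suc b) q ++ r ∷ downFrom r}
            | length-++ (interval (suc b) q) {r ∷ downFrom r}
            | length-interval (suc (suc r)) p | length-interval (suc b) q | length-downFrom r = refl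

  dbl : Doubleton (suc p) q (List.lookup l)
  dbl = doubleton-interval
    (inj₁ ≤-refl ∷ All.++⁺ (interval-all (suc b) q λ b≤ _ → inj₂ b≤)
      (inj₁ ≤-refl ∷ downFrom-all r (inj₁ ∘ m<n⇒m<1+n)))
    (doubleton-between
      (inj₁ (m<n⇒m<1+n r<b) ∷ downFrom-all r (λ y<r → inj₁ (<-trans y<r (m<n⇒m<1+n r<b))))
      (unique-∷-downFrom ≤-refl))

  sub : l ⊆ L ++ downFrom r
  sub = ⊆-trans
    (r ∷ʳ ++⁺ (⊆-refl {x = interval (suc r) (suc p)})
      (++⁺ˡ (replicate d 0) (⊆-refl {x = r ∷ interval (suc b) q ++ r ∷ downFrom r})))
    (⊆-reflexive (sym (trans (++-assoc (interval r (suc (suc p))) _ _)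
      (cong (interval r (suc (suc p)) ++_) (trans (++-assoc (replicate d 0) _ _)
        (cong (λ z → replicate d 0 ++ r ∷ z) (++-assoc (interval (suc b) q) _ _)))))))
witness zero q (suc r) d _ = mkWitness L l len≡ win all len dbl sub
  where
  b = suc r
  L = replicate d 0 ++ r ∷ interval b q ++ r ∷ [ b + q ]
  -- The `r` in the final stretch r, ..., 0 of the word cannot be used, as its label is the doubled
  -- one; the new label b + q replaces it among the singletons after the doubleton.
  l = r ∷ interval b q ++ r ∷ (b + q) ∷ downFrom r

  len≡ : suc (suc (q + suc b)) + d ≡ b + length L
  len≡ rewrite length-++ (replicate d 0) {r ∷ interval b q ++ r ∷ [ b + q ]}
             | length-++ (interval b q) {r ∷ [ b + q ]}
             | length-interval b q | length-replicate d {0}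
             = arith q r d
    where
    arith : ∀ q r d → suc (suc (q + suc (suc r))) + d ≡ suc r + (d + suc (q + 2))
    arith = solve-∀

  r<b : r < b + 0
  r<b = m≤m+n (suc r) 0

  win : Windowed (b + 0) q b (fromList L)
  win = windowed-zeros d z<s (inj₁ z<s) (windowed-old ≤-refl (inj₁ r<b)
    (windowed-interval b q (windowed-old (m≤m+n b q) (inj₁ r<b) (windowed-new []))))

  all : All (_< b + 0 + suc q) L
  all rewrite +-identityʳ r | +-suc r q = All.++⁺ (All.replicate⁺ d z<s)
    (s≤s (m≤n⇒m≤1+n (m≤m+n r q)) ∷ All.++⁺ (interval-all b q λ _ x< → m<n⇒m<1+n x<)
      (s≤s (m≤n⇒m≤1+n (m≤m+n r q)) ∷ ≤-refl ∷ []))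

  len : length l ≡ suc (q + suc b)
  len rewrite length-++ (interval b q) {r ∷ (b + q) ∷ downFrom r}
            | length-interval b q | length-downFrom r = refl

  dbl : Doubleton 0 q (List.lookup l)
  dbl = doubleton-between
    (inj₁ ≤-refl ∷ inj₂ ≤-refl ∷ downFrom-all r (inj₁ ∘ m<n⇒m<1+n))
    ((<⇒≢ (m≤m+n b q) ∷ downFrom-all r >⇒≢) ∷
      unique-∷-downFrom (≤-trans (n≤1+n r) (m≤m+n b q)))

  sub : l ⊆ L ++ downFrom b
  sub = subst (l ⊆_) (sym (trans (++-assoc (replicate d 0) _ _)
      (cong (λ z → replicate d 0 ++ r ∷ z) (++-assoc (interval b q) _ _))))
    (++⁺ˡ (replicate d 0) (refl ∷ ++⁺ (⊆-refl {x = interval b q}) (refl ∷ refl ∷ r ∷ʳ ⊆-refl)))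
witness zero (suc (suc q)) zero d _ = mkWitness L l len≡ win all len dbl sub
  where
  L = 0 ∷ 1 ∷ replicate d 0 ++ 0 ∷ interval 2 (suc q) ++ [ 1 ]
  l = 1 ∷ 0 ∷ interval 2 (suc q) ++ [ 1 ]

  len≡ : suc (suc (suc (suc q) + 1)) + d ≡ length L
  len≡ rewrite length-++ (replicate d 0) {0 ∷ interval 2 (suc q) ++ [ 1 ]}
             | length-++ (interval 2 (suc q)) {[ 1 ]}
             | length-interval 3 q | length-replicate d {0} = arith q d
    where
    arith : ∀ q d → suc (suc (suc (suc q) + 1)) + d ≡ suc (suc (d + suc (suc (q + 1))))
    arith = solve-∀

  win : Windowed 0 (suc (suc q)) 0 (fromList L)
  win = windowed-new (windowed-new (windowed-zeros d z<s (inj₂ 2≤)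
    (windowed-old z<s (inj₂ 2≤)
      -- At the last letter 1 exactly q + 3 blocks are open, so the window condition holds with
      -- equality.
      (windowed-interval 2 (suc q) (windowed-old (s<s z<s) (inj₂ ≤-refl) [])))))
    where
    2≤ : 2 ≤ suc (suc q)
    2≤ = s≤s (s≤s z≤n)

  all : All (_< suc (suc (suc q))) L
  all = z<s ∷ s<s z<s ∷ All.++⁺ (All.replicate⁺ d z<s)
    (z<s ∷ All.++⁺ (interval-all 2 (suc q) λ _ x< → x<) (s<s z<s ∷ []))

  len : length l ≡ suc (suc (suc q) + 1)
  len rewrite length-++ (interval 2 (suc q)) {[ 1 ]} | length-interval 3 q = refl

  dbl : Doubleton 0 (suc (suc q)) (List.lookup l)
  dbl = subst (λ j → Doubleton 0 j (List.lookup l)) (cong suc (length-interval 2 (suc q)))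
    (doubleton-head (0 ∷ interval 2 (suc q)) 1 []
      (All.++⁺ (interval-all 2 (suc q) λ 2≤ _ → <⇒≢ (<-trans z<s 2≤)) ((λ ()) ∷ []) ∷
       unique-interval {2} {suc q} (inj₁ (s<s z<s) ∷ []) ([] ∷ [])))

  sub : l ⊆ L ++ []
  sub = subst (l ⊆_) (sym (++-identityʳ L)) (0 ∷ʳ refl ∷ ++⁺ˡ (replicate d 0) ⊆-refl)
-- The two remaining cases have k at most 3.
witness zero zero       zero d ()
witness zero (suc zero) zero d (s≤s ())

-- Counting

words : ∀ {A : Set} → List A → (n : ℕ) → List (Vec A n)
words xs zero    = [ [] ]
words xs (suc n) = cartesianProductWith _∷_ xs (words xs n)

words-unique : ∀ {A : Set} {xs : List A} → Unique xs → ∀ n → Unique (words xs n)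
words-unique u zero    = [] ∷ []
words-unique u (suc n) = Unique.cartesianProductWith⁺ _∷_ ∷-injective u (words-unique u n)

∈-words : ∀ {A : Set} {xs : List A} (v : Vec A n) → (∀ i → lookup v i ∈ xs) → v ∈ words xs n
∈-words []      _  = here refl
∈-words (x ∷ v) ∈xs = ∈-cartesianProductWith⁺ _∷_ (∈xs zero) (∈-words v (∈xs ∘ suc))

rgs-< : (v : Vec ℕ n) → RGSFrom m v → ∀ i → lookup v i < m + n
rgs-< {suc n} {m} (x ∷ v) (x≤m ∷ _) zero    = ≤-<-trans x≤m (m<m+n m z<s)
rgs-< {suc n} {m} (x ∷ v) (x≤m ∷ r) (suc i) = <-≤-trans (rgs-< v r i)
  (subst ((m ⊔ suc x) + n ≤_) (sym (+-suc m n)) (+-monoˡ-≤ n (⊔-lub (n≤1+n m) (s≤s x≤m))))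

rgs? : ∀ m (v : Vec ℕ n) → Dec (RGSFrom m v)
rgs? m []      = yes []
rgs? m (x ∷ v) = map′ (λ (x≤m , r) → x≤m ∷ r) (λ { (x≤m ∷ r) → x≤m , r })
                   (x ≤? m ×-dec rgs? (m ⊔ suc x) v)

-- Occurrences are sought among the finitely many vectors of `k` positions, each map being replaced
-- by its table of values.
contains? : (π : Vec ℕ n) (τ : Vec ℕ k) → Dec (Contains π τ)
contains? {n} {k} π τ = map′ toContains fromContains (any? occurrence? (words (allFin n) k))
  where
  Occurrence : Vec (Fin n) k → Set
  Occurrence f = (∀ i j → i <ᶠ j → lookup f i <ᶠ lookup f j) ×
    (∀ i j → (lookup π (lookup f i) ≡ lookup π (lookup f j)) ⇔ (lookup τ i ≡ lookup τ j))

  occurrence? : ∀ f → Dec (Occurrence f)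
  occurrence? f =
    Fin.all? (λ i → Fin.all? λ j → (i Fin.<? j) →-dec (lookup f i Fin.<? lookup f j)) ×-dec
    Fin.all? (λ i → Fin.all? λ j →
      let P? = lookup π (lookup f i) ≟ lookup π (lookup f j) ; Q? = lookup τ i ≟ lookup τ j in
      map′ (λ (g , h) → mk⇔ g h) (λ e → to e , from e) ((P? →-dec Q?) ×-dec (Q? →-dec P?)))

  toContains : Any Occurrence (words (allFin n) k) → Contains π τ
  toContains a = let f , occ = Any.satisfied a in lookup f , occ

  fromContains : Contains π τ → Any Occurrence (words (allFin n) k)
  fromContains (f , mono , ker) = Any.map (λ { refl → occ })
    (∈-words (tabulate f) (λ _ → ∈-allFin _))
    where
    occ : Occurrence (tabulate f)
    occ = (λ i j i<j → subst₂ _<ᶠ_ (sym (lookup∘tabulate f i)) (sym (lookup∘tabulate f j)) (mono i j i<j)) ,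
          (λ i j → subst₂ (λ a b → (lookup π a ≡ lookup π b) ⇔ (lookup τ i ≡ lookup τ j))
                     (sym (lookup∘tabulate f i)) (sym (lookup∘tabulate f j)) (ker i j))

inΠ? : (τ : Vec ℕ k) (v : Vec ℕ n) → Dec (InΠ n τ v)
inΠ? τ v = rgs? 0 v ×-dec ¬? (contains? v τ)

-- The letters of a restricted growth string of length `n` are below `n`, so no partition is lost by
-- searching the words over `upTo n`.
partitions : ∀ n → Vec ℕ k → List (Vec ℕ n)
partitions n τ = filter (inΠ? τ) (words (upTo n) n)

partitions-unique : ∀ n (τ : Vec ℕ k) → Unique (partitions n τ)
partitions-unique n τ = Unique.filter⁺ (inΠ? τ) (words-unique (Unique.upTo⁺ n) n)

∈-partitions⁺ : (τ : Vec ℕ k) {v : Vec ℕ n} → InΠ n τ v → v ∈ partitions n τ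
∈-partitions⁺ τ {v} h@(rgs , _) = ∈-filter⁺ (inΠ? τ) (∈-words v λ i → ∈-upTo⁺ (rgs-< v rgs i)) h

∈-partitions⁻ : (τ : Vec ℕ k) {v : Vec ℕ n} → v ∈ partitions n τ → InΠ n τ v
∈-partitions⁻ {n = n} τ v∈ = proj₂ (∈-filter⁻ (inΠ? τ) {xs = words (upTo n) n} v∈)

hasSize-partitions : ∀ n (τ : Vec ℕ k) → HasSize (InΠ n τ) (length (partitions n τ))
hasSize-partitions n τ = partitions n τ , partitions-unique n τ , refl ,
  λ v → mk⇔ (∈-partitions⁻ τ) (∈-partitions⁺ τ)

-- The missed `y₀` takes index zero and an image of each element of `xs` takes a later index, which
-- injects one more index than `xs` has into those of `ys`.
length-< : ∀ {A B : Set} (R : A → B → Set) {xs ys} → Unique xs →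
  (∀ {x} → x ∈ xs → ∃[ y ] (y ∈ ys × R x y)) → (∀ {x x′ y} → R x y → R x′ y → x ≡ x′) →
  ∀ {y₀} → y₀ ∈ ys → (∀ {x} → x ∈ xs → ¬ R x y₀) → length xs < length ys
length-< R {xs} {ys} u image inj {y₀} y₀∈ missed = Fin.injective⇒≤ {f = f} f-injective
  where
  f : Fin (suc (length xs)) → Fin (length ys)
  f zero    = Any.index y₀∈
  f (suc i) = Any.index (proj₁ (proj₂ (image (∈-lookup {xs = xs} i))))

  related : ∀ i → R (List.lookup xs i) (List.lookup ys (f (suc i)))
  related i = let _ , y∈ , h = image (∈-lookup i) in subst (R _) (lookup-index y∈) h

  missed′ : ∀ i → f zero ≢ f (suc i)
  missed′ i eq = missed (∈-lookup i) (subst (R _)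
    (trans (cong (List.lookup ys) (sym eq)) (sym (lookup-index y₀∈))) (related i))

  f-injective : ∀ {i j} → f i ≡ f j → i ≡ j
  f-injective {zero}  {zero}  _  = refl
  f-injective {zero}  {suc j} eq = contradiction eq (missed′ j)
  f-injective {suc i} {zero}  eq = contradiction (sym eq) (missed′ i)
  f-injective {suc i} {suc j} eq = cong suc (lookup-injective u i j
    (inj (related i) (subst (R _) (cong (List.lookup ys) (sym eq)) (related j))))

-- The injection into the partitions avoiding `σ k`, and a partition it misses

few-labels⇒avoids-σ : ∀ {K} (w : Vec ℕ n) → K < k → (∀ i → lookup w i < K) → Avoids w (σ k)
few-labels⇒avoids-σ w K<k labels (f , _ , ker)
  with i , j , i<j , eq ← Fin.pigeonhole K<k (λ i → fromℕ< (labels (f i))) =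
  <⇒≢ i<j (trans (sym (lookup∘tabulate toℕ i)) (trans (to (ker i j) same) (lookup∘tabulate toℕ j)))
  where
  same : lookup w (f i) ≡ lookup w (f j)
  same = trans (sym (Fin.toℕ-fromℕ< (labels (f i)))) (trans (cong toℕ eq) (Fin.toℕ-fromℕ< (labels (f j))))

-- For r = 0 all reading is from the left, so `arrange` is the identity and its injectivity is
-- uniqueness of the canonical form.
rgs-sameKernel⇒≡ : {v w : Vec ℕ n} → IsRGS v → IsRGS w → SameKernel v w → v ≡ w
rgs-sameKernel⇒≡ {v = v} {w} rv rw h = arrange-sameKernel-injective 0 rv rw
  (subst₂ SameKernel (sym (arrange-from-left z≤n v)) (sym (arrange-from-left z≤n w)) h)

module _ (p q r : ℕ) (δ : Vec ℕ k) (k≡ : k ≡ p + suc (q + suc r)) (dδ : Doubleton p q (lookup δ))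
  where

  private
    b = r + p
    -- This is k - 1, the largest number of blocks of a partition avoiding `σ k`.
    K = b + suc q

  K<k : K < k
  K<k = subst (suc K ≤_) (sym k≡) (≤-reflexive (arith p q r))
    where
    arith : ∀ p q r → suc (r + p + suc q) ≡ p + suc (q + suc r)
    arith = solve-∀

  -- The graph of the injection: `u` is read as `c`, the letters of `c` are folded, and the folded
  -- word is laid out again to give the partition `z`.
  Related : Vec ℕ n → Vec ℕ n → Set
  Related u z = IsRGS u × ∃[ c ] (Windowed b q 0 c × SameKernel u (arrange r 0 c) ×
                                   SameKernel (arrange r 0 (map (fold b q) c)) z)

  -- The partition `z` determines the folded reading order, and the windows then determine the
  -- unfolded one.
  folded-equal : {c d z : Vec ℕ n} → Windowed b q 0 c → Windowed b q 0 d →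
    SameKernel (arrange r 0 (map (fold b q) c)) z → SameKernel (arrange r 0 (map (fold b q) d)) z →
    c ≡ d
  folded-equal wc wd hc hd = fold-word-injective b q wc wd
    (arrange-sameKernel-injective r
      (fold-word-rgs b q (windowed⇒rgs wc)) (fold-word-rgs b q (windowed⇒rgs wd))
      (sameKernel-trans hc (sameKernel-sym hd)))

  related-injective : {u v z : Vec ℕ n} → Related u z → Related v z → u ≡ v
  related-injective (ru , c , wc , uc , cz) (rv , d , wd , vd , dz)
    with refl ← folded-equal wc wd cz dz =
    rgs-sameKernel⇒≡ ru rv (sameKernel-trans uc (sameKernel-sym vd))

  canonical : (w : Vec ℕ n) → (∀ i → lookup w i < K) →
              ∃[ z ] (InΠ n (σ k) z × SameKernel w z)
  canonical w labels with z , rz , h ← arrange-exists 0 w =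
    z , (rz , λ occ → few-labels⇒avoids-σ w K<k labels (contains-resp (σ k) (sameKernel-sym wz) occ)) , wz
    where
    wz : SameKernel w z
    wz = subst (SameKernel w) (arrange-from-left z≤n z) h

  related-exists : {u : Vec ℕ n} → InΠ n δ u → ∃[ z ] (InΠ n (σ k) z × Related u z)
  related-exists {u = u} (ru , avoids) with c , rc , uc ← arrange-exists r u =
    let z , z∈ , h = canonical (arrange r 0 (map (fold b q) c)) labels
    in z , z∈ , ru , c , win , uc , h
    where
    labels : ∀ i → lookup (arrange r 0 (map (fold b q) c)) i < K
    labels = arrange-all (_< K) r 0 (map (fold b q) c)
      (λ i → subst (_< K) (sym (lookup-map i (fold b q) c)) (fold-< b q (lookup c i)))

    win : Windowed b q 0 c
    win = ¬occurs⇒windowed p q r [] c rc z≤n [] λ (x , b≤x , sub) →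
      avoids (contains-resp δ (sameKernel-sym uc)
        (sublist⇒contains {δ = δ} (trans (pattern-length p q r x) (sym k≡)) (pattern-doubleton p q r b≤x) dδ
          (subst (_ ⊆_) (++-identityʳ _) sub)))

  map-fold-id : (c : Vec ℕ n) → (∀ i → lookup c i < K) → map (fold b q) c ≡ c
  map-fold-id []      _   = refl
  map-fold-id (x ∷ c) all = cong₂ _∷_ (fold-id b q (all zero)) (map-fold-id c (all ∘ suc))

  -- The reading order `c` is its own fold, so a `u` related to `z` would have reading order `c`,
  -- and would contain `δ` as the word of `c` does.
  missed : Witness p q r n → ∃[ z ] (InΠ n (σ k) z × (∀ {u} → InΠ n δ u → ¬ Related u z))
  missed (c , wc , labels , l , len , dl , sub) =
    let z , z∈ , h = canonical (arrange r 0 c) (arrange-all (_< K) r 0 c labels)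
    in z , z∈ , λ { (_ , avoids) (_ , d , wd , ud , dz) → avoids (contains-resp δ
         (sameKernel-sym (subst (λ e → SameKernel _ (arrange r 0 e))
           (folded-equal wd wc dz (subst (λ e → SameKernel (arrange r 0 e) z) (sym (map-fold-id c labels)) h)) ud))
         (sublist⇒contains {δ = δ} (trans len (sym k≡)) dl dδ sub)) }

  cardLt : ∀ {n} → 4 ≤ k → k < n → CardLt n δ (σ k)
  -- Here n = k + 1 + d, and `d` becomes the number of padding zeros.
  cardLt {n} 4≤k k<n with d , n≡ ← m≤n⇒∃[o]m+o≡n k<n =
    let y₀ , y₀∈ , miss = missed (subst (Witness p q r) (trans (cong (λ j → suc j + d) (sym k≡)) n≡)
                                   (witness p q r d 2≤))
    in _ , _ , hasSize-partitions n δ , hasSize-partitions n (σ k) ,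
       length-< Related (partitions-unique n δ)
         (λ u∈ → let z , z∈ , h = related-exists (∈-partitions⁻ δ u∈) in z , ∈-partitions⁺ (σ k) z∈ , h)
         related-injective (∈-partitions⁺ (σ k) y₀∈) (miss ∘ ∈-partitions⁻ δ)
    where
    2≤ : 2 ≤ p + (q + r)
    2≤ = +-cancelˡ-≤ 2 _ _ (subst (4 ≤_) (trans k≡ (arith p q r)) 4≤k)
      where
      arith : ∀ p q r → p + suc (q + suc r) ≡ 2 + (p + (q + r))
      arith = solve-∀

theorem3p4 : (k : ℕ) → 4 ≤ k → (δ : Vec ℕ k) → IsRGS δ → OneDoubleton δ →
    ((n : ℕ) → k < n → CardLt n δ (σ k)) × (δ ≺ σ k)
theorem3p4 k 4≤k δ _ od with p , q , r , k≡ , dδ ← oneDoubleton⇒doubleton δ od =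
  lt , (λ n k<n → let a , b , ha , hb , a<b = lt n k<n in a , b , ha , hb , <⇒≤ a<b) ,
  k , ≤-refl , lt
  where
  lt : ∀ n → k < n → CardLt n δ (σ k)
  lt n = cardLt p q r δ k≡ dδ 4≤k
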